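{- Let $\mathcal{F}=\mathcal{B}(K_3)$. Then $R_3(\mathcal{F},2)=R_3(\mathcal{F},3)=5$, $R_3(\mathcal{F},4)=6$, $R_3(\mathcal{F},5)=7$, $R_3(\mathcal{F},6)=8$, and $R_3(\mathcal{F},8)=9$.
   Context: For a graph $G$, a hypergraph $H$ is a Berge-$G$ hypergraph if there are an injective map $\phi:V(G)\to V(H)$ and pairwise distinct hyperedges $e_{xy}\in E(H)$, one for each $xy\in E(G)$, with $\phi(x),\phi(y)\in e_{xy}$. $\mathcal{B}(G)$ denotes the family of all Berge-$G$ hypergraphs. $K_n^r$ denotes the complete $r$-uniform hypergraph on $n$ vertices. For a family $\mathcal{H}$ of $r$-uniform hypergraphs and integers $k\ge 2$, $r\ge 2$, the Ramsey number $R_r(\mathcal{H},k)$ is the smallest integer $n$ such that every coloring of the hyperedges of $K_n^r$ with $k$ colors contains a monochromatic subhypergraph belonging to $\mathcal{H}$. -}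

module Defs where

open import Data.Fin.Base using (Fin)
open import Data.Fin.Subset using (Subset; _∈_; _⊆_; ⊤; ∣_∣)
open import Data.Fin.Subset.Properties using (⊆⊤)
open import Data.Nat.Base using (ℕ; _≤_)
open import Data.Product.Base using (Σ; ∃; _×_; proj₁)
open import Function.Definitions using (Injective)
open import Level using (0ℓ; suc)
open import Relation.Binary.PropositionalEquality using (_≡_)
open import Relation.Unary using (Pred)

-- The vertex set is a subset of the ambient Fin n, so that a subhypergraph
-- may have fewer vertices while living over the same Fin n.
record Hypergraph (n : ℕ) : Set₁ where
  field
    V   : Subset n
    E   : Pred (Subset n) 0ℓ
    E⊆V : ∀ e → E e → e ⊆ V

open Hypergraph public

-- A simple graph with vertex set all of Fin m; an edge xy is the
-- two-element subset {x, y}.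
record Graph (m : ℕ) : Set₁ where
  field
    edge       : Pred (Subset m) 0ℓ
    edge-size  : ∀ f → edge f → ∣ f ∣ ≡ 2

open Graph public

completeGraph : ∀ m → Graph m
completeGraph m = record { edge = λ f → ∣ f ∣ ≡ 2 ; edge-size = λ _ p → p }

completeHypergraph : (r n : ℕ) → Hypergraph n
completeHypergraph r n = record
  { V   = ⊤
  ; E   = λ e → ∣ e ∣ ≡ r
  ; E⊆V = λ _ _ → ⊆⊤
  }

infix 4 _⊑_

_⊑_ : ∀ {n} → Hypergraph n → Hypergraph n → Set
H ⊑ K = V H ⊆ V K × (∀ e → E H e → E K e)

-- The hyperedge chosen for an edge f of G is ε f; the values of ε at subsets
-- that are not edges of G are irrelevant.
record IsBerge {m : ℕ} (G : Graph m) {n : ℕ} (H : Hypergraph n) : Set where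
  field
    φ          : Fin m → Fin n
    φ∈V        : ∀ x → φ x ∈ V H
    φ-inj      : Injective _≡_ _≡_ φ
    ε          : Subset m → Subset n
    ε∈E        : ∀ f → edge G f → E H (ε f)
    ε-distinct : ∀ f g → edge G f → edge G g → ε f ≡ ε g → f ≡ g
    φ∈ε        : ∀ f → edge G f → ∀ x → x ∈ f → φ x ∈ ε f

Family : Set₁
Family = ∀ n → Pred (Hypergraph n) 0ℓ

𝓑 : ∀ {m} → Graph m → Family
𝓑 G n H = IsBerge G H

Coloring : ∀ {n} → Hypergraph n → ℕ → Set
Coloring K k = ∃ (E K) → Fin k

Monochromatic : ∀ {n k} {K : Hypergraph n} → Coloring K k → Hypergraph n → Set
Monochromatic {k = k} {K = K} c H =
  Σ (Fin k) λ i → (e : ∃ (E K)) → E H (proj₁ e) → c e ≡ i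

HasRamseyProperty : (r : ℕ) → Family → (k n : ℕ) → Set₁
HasRamseyProperty r 𝓗 k n =
  (c : Coloring (completeHypergraph r n) k) →
  Σ (Hypergraph n) λ H →
    H ⊑ completeHypergraph r n ×
    Monochromatic {K = completeHypergraph r n} c H ×
    𝓗 n H

IsLeast : Pred ℕ (suc 0ℓ) → Pred ℕ (suc 0ℓ)
IsLeast P n = P n × (∀ m → P m → n ≤ m)

-- The Ramsey number as a relation: RamseyNumber r 𝓗 k n says R_r(𝓗, k) = n.
RamseyNumber : (r : ℕ) → Family → (k n : ℕ) → Set₁
RamseyNumber r 𝓗 k = IsLeast (HasRamseyProperty r 𝓗 k)

{-# OPTIONS --safe #-}
module Submission where

-- Let H be a 3-uniform hypergraph without a Berge triangle.  A hyperedge xyz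
-- has at most one pair lying in another hyperedge: if xy ⊂ e and yz ⊂ f, then
-- e, f and xyz would form a Berge triangle on x, y, z.  So each hyperedge has
-- two private pairs, and the graph of two chosen private pairs per hyperedge
-- is triangle-free.  By Mantel's theorem 2|H| ≤ n²/4, and for the upper bounds
-- k · n²/8 < C(n,3) suffices.  The lower bounds are explicit colourings.

open import Defs
open import Data.Bool.Base using (true; false; if_then_else_)
import Data.Bool.Properties as Bool
open import Data.Bool.ListAction using (any)
open import Data.Empty using (⊥)
open import Data.Fin.Base as Fin using (Fin; zero; suc)
open import Data.Fin.Patterns using (0F; 1F; 2F)
import Data.Fin.Properties as Fin
open import Data.Fin.Subset using (Subset; inside; outside; _∈_; _∉_; _∪_; ⁅_⁆; ∣_∣)
open import Data.Fin.Subset.Properties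
  using (_∈?_; anySubset?; ∪-comm; ∪-assoc; ∪-idem; ∣⁅x⁆∣≡1; x∈⁅x⁆; x∈⁅y⁆⇒x≡y; x∈p∪q⁺; x∈p∪q⁻; ⊆⊤)
open import Data.List.Base using (List; []; _∷_)
open import Data.Nat.Base using (ℕ; zero; suc; _+_; _*_; _≤_; _<_; z≤n; s≤s; _≡ᵇ_)
open import Data.Nat.Properties
open import Data.Nat.Tactic.RingSolver using (solve-∀)
open import Data.Product.Base using (∃; ∃-syntax; _×_; _,_; proj₁; proj₂)
open import Data.Sum.Base using (_⊎_; inj₁; inj₂; [_,_])
open import Data.Vec.Base using (Vec; []; _∷_; here; there)
import Data.Vec.Properties as Vec
open import Data.Vec.Functional using (Vector)
open import Function.Base using (_∘_; case_of_)
open import Relation.Binary.PropositionalEquality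
  using (_≡_; _≢_; refl; sym; trans; cong; cong₂; subst)
open import Relation.Binary.Definitions using (tri<; tri≈; tri>)
open import Relation.Nullary.Decidable
  using (Dec; yes; no; does; map′; _×-dec_; _⊎-dec_; ¬?; True; toWitness; decidable-stable)
open import Relation.Nullary.Negation using (¬_; contradiction)
open import Relation.Unary using (Pred; Decidable)
open import Level using (0ℓ)
open import Algebra.Properties.Semiring.Sum +-*-semiring
  using (sum; ∑-distrib-+; ∑-comm; sum-cong-≗; *-distribˡ-sum; *-distribʳ-sum; sum-syntax)

private variable
  m n k : ℕ

-- Finite sums

sum-mono-≤ : {f g : Vector ℕ n} → (∀ i → f i ≤ g i) → sum f ≤ sum g
sum-mono-≤ {n = zero}  f≤g = z≤n
sum-mono-≤ {n = suc n} f≤g = +-mono-≤ (f≤g zero) (sum-mono-≤ (f≤g ∘ suc))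

sum-const : ∀ n c → sum {n} (λ _ → c) ≡ n * c
sum-const zero    c = refl
sum-const (suc n) c = cong (c +_) (sum-const n c)

term≤sum : (f : Vector ℕ n) → ∀ i → f i ≤ sum f
term≤sum f zero    = m≤m+n _ _
term≤sum f (suc i) = ≤-trans (term≤sum (f ∘ suc) i) (m≤n+m _ _)

∑² : (Fin n → Fin n → ℕ) → ℕ
∑² f = ∑[ x < _ ] ∑[ y < _ ] f x y

∑²-mono-≤ : {f g : Fin n → Fin n → ℕ} → (∀ x y → f x y ≤ g x y) → ∑² f ≤ ∑² g
∑²-mono-≤ f≤g = sum-mono-≤ λ x → sum-mono-≤ (f≤g x)

∑²-cong : {f g : Fin n → Fin n → ℕ} → (∀ x y → f x y ≡ g x y) → ∑² f ≡ ∑² g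
∑²-cong f≗g = sum-cong-≗ λ x → sum-cong-≗ (f≗g x)

∑²-distrib-+ : (f g : Fin n → Fin n → ℕ) → ∑² (λ x y → f x y + g x y) ≡ ∑² f + ∑² g
∑²-distrib-+ f g =
  trans (sum-cong-≗ λ x → ∑-distrib-+ (f x) (g x)) (∑-distrib-+ (sum ∘ f) (sum ∘ g))

∑³ : (Fin n → Fin n → Fin n → ℕ) → ℕ
∑³ f = ∑[ x < _ ] ∑² (f x)

∑³-mono-≤ : {f g : Fin n → Fin n → Fin n → ℕ} →
            (∀ x y z → f x y z ≤ g x y z) → ∑³ f ≤ ∑³ g
∑³-mono-≤ f≤g = sum-mono-≤ λ x → ∑²-mono-≤ (f≤g x)

∑³-distrib-+ : (f g : Fin n → Fin n → Fin n → ℕ) →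
               ∑³ (λ x y z → f x y z + g x y z) ≡ ∑³ f + ∑³ g
∑³-distrib-+ f g =
  trans (sum-cong-≗ λ x → ∑²-distrib-+ (f x) (g x)) (∑-distrib-+ (∑² ∘ f) (∑² ∘ g))

∑³-rotate : (f : Fin n → Fin n → Fin n → ℕ) → ∑³ (λ x y z → f y z x) ≡ ∑³ f
∑³-rotate f =
  trans (∑-comm λ x y → ∑[ z < _ ] f y z x)
        (sum-cong-≗ λ y → ∑-comm λ x z → f y z x)

∑³-∑-comm : (f : Fin n → Fin n → Fin n → Fin k → ℕ) →
            ∑³ (λ x y z → ∑[ i < k ] f x y z i) ≡ ∑[ i < k ] ∑³ (λ x y z → f x y z i)
∑³-∑-comm f =
  trans (∑²-cong λ x y → ∑-comm (f x y))
 (trans (sum-cong-≗ λ x → ∑-comm λ y i → ∑[ z < _ ] f x y z i)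
        (∑-comm λ x i → ∑² λ y z → f x y z i))

𝟙 : {P : Set} → Dec P → ℕ
𝟙 d = if does d then 1 else 0

𝟙-yes : {P : Set} (d : Dec P) → P → 1 ≤ 𝟙 d
𝟙-yes (yes _) _ = s≤s z≤n
𝟙-yes (no ¬p) p = contradiction p ¬p

𝟙≤ : {P : Set} (d : Dec P) {a : ℕ} → (P → 1 ≤ a) → 𝟙 d ≤ a
𝟙≤ (yes p) h = h p
𝟙≤ (no _)  h = z≤n

𝟙-mono : {P Q : Set} (d : Dec P) (d′ : Dec Q) → (P → Q) → 𝟙 d ≤ 𝟙 d′
𝟙-mono d d′ h = 𝟙≤ d (𝟙-yes d′ ∘ h)

𝟙-cong : {P Q : Set} (d : Dec P) (d′ : Dec Q) → (P → Q) → (Q → P) → 𝟙 d ≡ 𝟙 d′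
𝟙-cong d d′ h h′ = ≤-antisym (𝟙-mono d d′ h) (𝟙-mono d′ d h′)

TwoOf : Set → Set → Set → Set
TwoOf A B C = (A × B) ⊎ (B × C) ⊎ (A × C)

𝟙-TwoOf : {P A B C : Set} (d : Dec P) (a : Dec A) (b : Dec B) (c : Dec C) →
          (P → TwoOf A B C) → 𝟙 d + 𝟙 d ≤ 𝟙 a + (𝟙 b + 𝟙 c)
𝟙-TwoOf (no _)  a b c h = z≤n
𝟙-TwoOf (yes p) a b c h with h p
... | inj₁ (p , q)        = +-mono-≤ (𝟙-yes a p) (m≤n⇒m≤n+o _ (𝟙-yes b q))
... | inj₂ (inj₁ (q , r)) = m≤n⇒m≤o+n (𝟙 a) (+-mono-≤ (𝟙-yes b q) (𝟙-yes c r))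
... | inj₂ (inj₂ (p , r)) = +-mono-≤ (𝟙-yes a p) (m≤n⇒m≤o+n _ (𝟙-yes c r))

sum-no : {P : Pred (Fin n) 0ℓ} (P? : Decidable P) → (∀ i → ¬ P i) → sum (𝟙 ∘ P?) ≤ 0
sum-no {n} P? ¬P = ≤-trans (sum-mono-≤ λ i → 𝟙≤ (P? i) λ p → contradiction p (¬P i))
                           (≤-reflexive (trans (sum-const n 0) (*-zeroʳ n)))

sum-unique≤1 : {P : Pred (Fin n) 0ℓ} (P? : Decidable P) →
               (∀ i j → P i → P j → i ≡ j) → sum (𝟙 ∘ P?) ≤ 1
sum-unique≤1 {n = zero}  P? unique = z≤n
sum-unique≤1 {n = suc n} P? unique with P? zero
... | yes p = s≤s (sum-no (P? ∘ suc) λ i q → case unique zero (suc i) p q of λ ())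
... | no  _ = sum-unique≤1 (P? ∘ suc) λ i j p q → Fin.suc-injective (unique (suc i) (suc j) p q)

-- Lets a sum over the third vertex of a triple collapse to one indicator per ordered pair of
-- vertices.
sum-unique≤ : {P : Pred (Fin n) 0ℓ} (P? : Decidable P) →
              (∀ i j → P i → P j → i ≡ j) → sum (𝟙 ∘ P?) ≤ 𝟙 (Fin.any? P?)
sum-unique≤ P? unique with Fin.any? P?
... | yes _ = sum-unique≤1 P? unique
... | no ¬∃ = sum-no P? λ i p → ¬∃ (i , p)

-- Mantel's theorem

2ab≤a²+b² : ∀ a b → 2 * (a * b) ≤ a * a + b * b
2ab≤a²+b² a b with ≤-total a b
... | inj₁ a≤b with t , refl ← m≤n⇒∃[o]m+o≡n a≤b =
  ≤-trans (m≤m+n _ (t * t)) (≤-reflexive (square-of-difference a t))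
  where
  square-of-difference : ∀ a t → 2 * (a * (a + t)) + t * t ≡ a * a + (a + t) * (a + t)
  square-of-difference = solve-∀
... | inj₂ b≤a with t , refl ← m≤n⇒∃[o]m+o≡n b≤a =
  ≤-trans (m≤m+n _ (t * t)) (≤-reflexive (square-of-difference b t))
  where
  square-of-difference : ∀ b t → 2 * ((b + t) * b) + t * t ≡ (b + t) * (b + t) + b * b
  square-of-difference = solve-∀

module Mantel
  {n : ℕ} {Adj : Fin n → Fin n → Set} (adj? : ∀ x y → Dec (Adj x y))
  (Adj-sym : ∀ {x y} → Adj x y → Adj y x)
  (triangle-free : ∀ {x y z} → Adj x y → Adj y z → Adj x z → ⊥) where

  a : Fin n → Fin n → ℕ
  a x y = 𝟙 (adj? x y)

  degree : Fin n → ℕ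
  degree x = sum (a x)

  a-sym : ∀ x y → a x y ≡ a y x
  a-sym x y = 𝟙-cong (adj? x y) (adj? y x) Adj-sym Adj-sym

  -- A common neighbour would close a triangle, so the two neighbourhoods are disjoint.
  adjacent-degrees : ∀ {x y} → Adj x y → degree x + degree y ≤ n
  adjacent-degrees {x} {y} xy = begin
    degree x + degree y        ≡⟨ ∑-distrib-+ (a x) (a y) ⟨
    sum (λ z → a x z + a y z)  ≤⟨ sum-mono-≤ no-common-neighbour ⟩
    sum {n} (λ _ → 1)          ≡⟨ trans (sum-const n 1) (*-identityʳ n) ⟩
    n                          ∎
    where
    open ≤-Reasoning
    no-common-neighbour : ∀ z → a x z + a y z ≤ 1
    no-common-neighbour z with adj? x z | adj? y z
    ... | yes xz | yes yz = contradiction xz (triangle-free xy yz)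
    ... | yes _  | no _   = ≤-refl
    ... | no _   | yes _  = ≤-refl
    ... | no _   | no _   = z≤n

  ∑degree² : ℕ
  ∑degree² = sum λ x → degree x * degree x

  -- Double counting: summing `degree x + degree y` over ordered adjacent pairs counts each vertex's
  -- degree once per incidence at either end, while every pair contributes at most `n`.
  2∑degree²≤ : 2 * ∑degree² ≤ n * ∑² a
  2∑degree²≤ = begin
    2 * ∑degree²                                           ≡⟨ cong (∑degree² +_) (+-identityʳ _) ⟩
    ∑degree² + ∑degree²                                    ≡⟨ cong₂ _+_ left right ⟨
    ∑² (λ x y → a x y * degree x) + ∑² (λ x y → a x y * degree y)
      ≡⟨ ∑²-distrib-+ (λ x y → a x y * degree x) (λ x y → a x y * degree y) ⟨
    ∑² (λ x y → a x y * degree x + a x y * degree y)       ≤⟨ ∑²-mono-≤ pointwise ⟩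
    ∑² (λ x y → n * a x y)                                 ≡⟨ sum-cong-≗ (λ x → *-distribˡ-sum n (a x)) ⟨
    sum (λ x → n * degree x)                               ≡⟨ *-distribˡ-sum n degree ⟨
    n * ∑² a                                               ∎
    where
    open ≤-Reasoning
    left : ∑² (λ x y → a x y * degree x) ≡ ∑degree²
    left = sum-cong-≗ λ x → sym (*-distribʳ-sum (degree x) (a x))

    right : ∑² (λ x y → a x y * degree y) ≡ ∑degree²
    right = trans (∑-comm λ x y → a x y * degree y)
           (trans (∑²-cong λ y x → cong (_* degree y) (a-sym x y)) left)

    pointwise : ∀ x y → a x y * degree x + a x y * degree y ≤ n * a x y
    pointwise x y with adj? x y
    ... | yes xy rewrite *-identityʳ n | +-identityʳ (degree x) | +-identityʳ (degree y) =
      adjacent-degrees xy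
    ... | no _   = z≤n

  4n∑≤ : 4 * (n * ∑² a) ≤ 4 * ∑degree² + n * (n * n)
  4n∑≤ = begin
    4 * (n * ∑² a)                                 ≡⟨ cong (4 *_) (*-distribˡ-sum n degree) ⟩
    4 * sum (λ x → n * degree x)                   ≡⟨ *-distribˡ-sum 4 (λ x → n * degree x) ⟩
    sum (λ x → 4 * (n * degree x))                 ≤⟨ sum-mono-≤ (tangent ∘ degree) ⟩
    sum (λ x → 4 * (degree x * degree x) + n * n)
      ≡⟨ ∑-distrib-+ (λ x → 4 * (degree x * degree x)) (λ _ → n * n) ⟩
    sum (λ x → 4 * (degree x * degree x)) + sum {n} (λ _ → n * n)
      ≡⟨ cong₂ _+_ (sym (*-distribˡ-sum 4 (λ x → degree x * degree x))) (sum-const n (n * n)) ⟩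
    4 * ∑degree² + n * (n * n)                     ∎
    where
    open ≤-Reasoning
    -- (2d − n)² ≥ 0; summed over the degrees it replaces Cauchy–Schwarz.
    tangent : ∀ d → 4 * (n * d) ≤ 4 * (d * d) + n * n
    tangent d = begin
      4 * (n * d)                ≡⟨ rearrangeˡ n d ⟩
      2 * ((2 * d) * n)          ≤⟨ 2ab≤a²+b² (2 * d) n ⟩
      (2 * d) * (2 * d) + n * n  ≡⟨ rearrangeʳ n d ⟩
      4 * (d * d) + n * n        ∎
      where
      rearrangeˡ : ∀ n d → 4 * (n * d) ≡ 2 * ((2 * d) * n)
      rearrangeˡ = solve-∀
      rearrangeʳ : ∀ n d → (2 * d) * (2 * d) + n * n ≡ 4 * (d * d) + n * n
      rearrangeʳ = solve-∀

  -- With S for `∑² a`, the two bounds chain to 4nS ≤ 2nS + n³, and 2nS cancels.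
  n*2∑≤n*n² : n * (2 * ∑² a) ≤ n * (n * n)
  n*2∑≤n*n² = +-cancelˡ-≤ (2 * (n * ∑² a)) _ _ (begin
    2 * (n * ∑² a) + n * (2 * ∑² a)  ≡⟨ rearrange n (∑² a) ⟩
    4 * (n * ∑² a)                   ≤⟨ 4n∑≤ ⟩
    4 * ∑degree² + n * (n * n)       ≡⟨ cong (_+ n * (n * n)) (*-assoc 2 2 ∑degree²) ⟩
    2 * (2 * ∑degree²) + n * (n * n) ≤⟨ +-monoˡ-≤ _ (*-monoʳ-≤ 2 2∑degree²≤) ⟩
    2 * (n * ∑² a) + n * (n * n)     ∎)
    where
    open ≤-Reasoning
    rearrange : ∀ n s → 2 * (n * s) + n * (2 * s) ≡ 4 * (n * s)
    rearrange = solve-∀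

-- The sum counts each edge in both directions, so this is the usual n²/4. The factor `n` is
-- cancelled at the end, hence the separate case of no vertices.
mantel : {Adj : Fin n → Fin n → Set} (adj? : ∀ x y → Dec (Adj x y)) →
         (∀ {x y} → Adj x y → Adj y x) →
         (∀ {x y z} → Adj x y → Adj y z → Adj x z → ⊥) →
         2 * ∑² (λ x y → 𝟙 (adj? x y)) ≤ n * n
mantel {zero}  adj? Adj-sym triangle-free = z≤n
mantel {suc n} adj? Adj-sym triangle-free =
  *-cancelˡ-≤ (suc n) (Mantel.n*2∑≤n*n² adj? Adj-sym triangle-free)

-- Triple systems without a Berge triangle

-- A hypergraph as a symmetric ternary relation, each hyperedge appearing as six ordered triples. In
-- `berge-free` the two inequalities keep z out of xyu and x out of yzv, which makes the three
-- hyperedges distinct even when `w` is `y`; `shared-once` uses exactly that case.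
module TripleSystem
  {n : ℕ} {E : Fin n → Fin n → Fin n → Set} (E? : ∀ x y z → Dec (E x y z))
  (E-swap : ∀ {x y z} → E x y z → E y x z)
  (E-rotate : ∀ {x y z} → E x y z → E y z x)
  (E-distinct : ∀ {x y z} → E x y z → x ≢ y)
  (berge-free : ∀ {x y z u v w} → E x y u → E y z v → E x z w → u ≢ z → v ≢ x → ⊥) where

  -- Here `z` is the third vertex of the hyperedge under consideration; a pair that is not shared is
  -- private to it.
  Shared : Fin n → Fin n → Fin n → Set
  Shared x y z = ∃[ u ] E x y u × u ≢ z

  shared? : ∀ x y z → Dec (Shared x y z)
  shared? x y z = Fin.any? λ u → E? x y u ×-dec ¬? (u Fin.≟ z)

  Shared-swap : ∀ {x y z} → Shared x y z → Shared y x z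
  Shared-swap (u , e , u≢z) = u , E-swap e , u≢z

  unique-private : ∀ {x y z u} → ¬ Shared x y z → E x y u → u ≡ z
  unique-private ¬s e = decidable-stable (_ Fin.≟ _) λ u≢z → ¬s (_ , e , u≢z)

  shared-once : ∀ {x y z} → E x y z → Shared x y z → ¬ Shared y z x
  shared-once e (u , f , u≢z) (v , g , v≢x) =
    berge-free f g (E-rotate (E-swap e)) u≢z v≢x

  -- xy is one of two private pairs picked from the hyperedge xyz: when all
  -- three pairs are private, the pair avoiding the least vertex is dropped.
  Selected : Fin n → Fin n → Fin n → Set
  Selected x y z = E x y z × ¬ Shared x y z ×
    (Shared y z x ⊎ Shared x z y ⊎ x Fin.< z ⊎ y Fin.< z)

  selected? : ∀ x y z → Dec (Selected x y z)
  selected? x y z = E? x y z ×-dec ¬? (shared? x y z) ×-dec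
    (shared? y z x ⊎-dec shared? x z y ⊎-dec x Fin.<? z ⊎-dec y Fin.<? z)

  Selected-swap : ∀ {x y z} → Selected x y z → Selected y x z
  Selected-swap (e , ¬s , r) = E-swap e , ¬s ∘ Shared-swap , swap r
    where
    swap : ∀ {A B C D : Set} → A ⊎ B ⊎ C ⊎ D → B ⊎ A ⊎ D ⊎ C
    swap (inj₁ a) = inj₂ (inj₁ a)
    swap (inj₂ (inj₁ b)) = inj₁ b
    swap (inj₂ (inj₂ (inj₁ c))) = inj₂ (inj₂ (inj₂ c))
    swap (inj₂ (inj₂ (inj₂ d))) = inj₂ (inj₂ (inj₁ d))

  Selected-unique : ∀ {x y z z′} → Selected x y z → Selected x y z′ → z ≡ z′
  Selected-unique (e , _) (_ , ¬s , _) = unique-private ¬s e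

  -- `shared-once`, applied to rotations of the hyperedge, makes the other two pairs private, and
  -- the shared pair xy is itself the reason for selecting them.
  selected-of-shared : ∀ {x y z} → E x y z → Shared x y z → Selected y z x × Selected z x y
  selected-of-shared e s =
    (E-rotate e , shared-once e s , inj₂ (inj₁ (Shared-swap s))) ,
    (E-rotate (E-rotate e) , (λ t → shared-once (E-rotate (E-rotate e)) t s) , inj₁ s)

  selected-of-least : ∀ {x y z} → E x y z → ¬ Shared x y z → ¬ Shared z x y →
                      x Fin.< y → x Fin.< z → Selected x y z × Selected z x y
  selected-of-least e ¬s ¬t x<y x<z =
    (e , ¬s , inj₂ (inj₂ (inj₁ x<z))) ,
    (E-rotate (E-rotate e) , ¬t , inj₂ (inj₂ (inj₂ x<y)))

  least : ∀ {x y z : Fin n} → x ≢ y → y ≢ z → z ≢ x →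
          (x Fin.< y × x Fin.< z) ⊎ (y Fin.< z × y Fin.< x) ⊎ (z Fin.< x × z Fin.< y)
  least {x} {y} {z} x≢y y≢z z≢x with Fin.<-cmp x y | Fin.<-cmp y z | Fin.<-cmp z x
  ... | tri≈ _ x≡y _ | _ | _ = contradiction x≡y x≢y
  ... | _ | tri≈ _ y≡z _ | _ = contradiction y≡z y≢z
  ... | _ | _ | tri≈ _ z≡x _ = contradiction z≡x z≢x
  ... | tri< x<y _ _ | _ | tri> _ _ x<z = inj₁ (x<y , x<z)
  ... | tri> _ _ y<x | tri< y<z _ _ | _ = inj₂ (inj₁ (y<z , y<x))
  ... | _ | tri> _ _ z<y | tri< z<x _ _ = inj₂ (inj₂ (z<x , z<y))
  ... | tri< x<y _ _ | tri< y<z _ _ | tri< z<x _ _ =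
    contradiction (<-trans x<y (<-trans y<z z<x)) (<-irrefl refl)
  ... | tri> _ _ y<x | tri> _ _ z<y | tri> _ _ x<z =
    contradiction (<-trans y<x (<-trans x<z z<y)) (<-irrefl refl)

  -- If some pair is shared, the other two are selected; otherwise the two pairs through the least
  -- vertex are. The cases differ only by rotation.
  two-selected : ∀ {x y z} → E x y z →
                 TwoOf (Selected x y z) (Selected y z x) (Selected z x y)
  two-selected {x} {y} {z} e with shared? x y z | shared? y z x | shared? z x y
  ... | yes s | _ | _ = inj₂ (inj₁ (selected-of-shared e s))
  ... | no _ | yes s | _ with p , q ← selected-of-shared (E-rotate e) s =
    inj₂ (inj₂ (q , p))
  ... | no _ | no _ | yes s = inj₁ (selected-of-shared (E-rotate (E-rotate e)) s)
  ... | no s | no t | no u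
    with least (E-distinct e) (E-distinct (E-rotate e)) (E-distinct (E-rotate (E-rotate e)))
  ...   | inj₁ (x<y , x<z) = inj₂ (inj₂ (selected-of-least e s u x<y x<z))
  ...   | inj₂ (inj₁ (y<z , y<x)) with p , q ← selected-of-least (E-rotate e) t s y<z y<x =
    inj₁ (q , p)
  ...   | inj₂ (inj₂ (z<x , z<y))
    with p , q ← selected-of-least (E-rotate (E-rotate e)) u t z<x z<y =
    inj₂ (inj₁ (q , p))

  Adj : Fin n → Fin n → Set
  Adj x y = ∃[ z ] Selected x y z

  adj? : ∀ x y → Dec (Adj x y)
  adj? x y = Fin.any? (selected? x y)

  Adj-sym : ∀ {x y} → Adj x y → Adj y x
  Adj-sym (z , q) = z , Selected-swap q

  -- With all three pairs private, only the order clauses of `Selected` can hold. Each says that the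
  -- vertex opposite its pair is not the least, which cannot be so for all three vertices.
  not-all-selected : ∀ {x y z} → Selected x y z → Selected y z x → Selected x z y → ⊥
  not-all-selected {x} {y} {z} (_ , ¬xy , p) (_ , ¬yz , q) (_ , ¬xz , r) =
    cyclic (ordered ¬yz ¬xz p)
           (ordered (¬xz ∘ Shared-swap) (¬xy ∘ Shared-swap) q)
           (ordered (¬yz ∘ Shared-swap) ¬xy r)
    where
    ordered : ∀ {A B C D : Set} → ¬ A → ¬ B → A ⊎ B ⊎ C ⊎ D → C ⊎ D
    ordered ¬a ¬b = [ (λ a → contradiction a ¬a) , [ (λ b → contradiction b ¬b) , (λ c → c) ] ]

    cyclic : (x Fin.< z ⊎ y Fin.< z) → (y Fin.< x ⊎ z Fin.< x) → (x Fin.< y ⊎ z Fin.< y) → ⊥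
    cyclic (inj₁ x<z) (inj₁ y<x) (inj₁ x<y) = <-asym x<y y<x
    cyclic (inj₁ x<z) (inj₁ y<x) (inj₂ z<y) = <-asym x<z (<-trans z<y y<x)
    cyclic (inj₁ x<z) (inj₂ z<x) _          = <-asym x<z z<x
    cyclic (inj₂ y<z) (inj₁ y<x) (inj₁ x<y) = <-asym x<y y<x
    cyclic (inj₂ y<z) _          (inj₂ z<y) = <-asym y<z z<y
    cyclic (inj₂ y<z) (inj₂ z<x) (inj₁ x<y) = <-asym x<y (<-trans y<z z<x)

  -- Let xyu, yzv and xzw be the selecting hyperedges. If u = z, privacy of yz and xz puts all three
  -- pairs in the one hyperedge xyz. If only v = x, then yzx contains xy, against privacy of xy in
  -- xyu. Otherwise they form a Berge triangle.
  Adj-triangle-free : ∀ {x y z} → Adj x y → Adj y z → Adj x z → ⊥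
  Adj-triangle-free {x} {y} {z} (u , p@(e , ¬xy , _)) (v , q@(f , ¬yz , _)) (w , r@(g , ¬xz , _))
    with u Fin.≟ z | v Fin.≟ x
  ... | no u≢z | no v≢x = berge-free e f g u≢z v≢x
  ... | yes refl | _
    with refl ← unique-private ¬yz (E-rotate e) | refl ← unique-private ¬xz (E-rotate (E-swap e)) =
    not-all-selected p q r
  ... | no u≢z | yes refl = u≢z (sym (unique-private ¬xy (E-rotate (E-rotate f))))

  -- Each hyperedge is counted six times, so this says |H| ≤ n²/8.
  4∑E≤3n² : 4 * ∑³ (λ x y z → 𝟙 (E? x y z)) ≤ 3 * (n * n)
  4∑E≤3n² = begin
    4 * #E                   ≡⟨ *-assoc 2 2 #E ⟩
    2 * (2 * #E)             ≤⟨ *-monoʳ-≤ 2 two-per-hyperedge ⟩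
    2 * (#Q + (#Q + #Q))     ≡⟨ rearrange #Q ⟩
    3 * (2 * #Q)             ≤⟨ *-monoʳ-≤ 3 (*-monoʳ-≤ 2 one-hyperedge-per-pair) ⟩
    3 * (2 * ∑² λ x y → 𝟙 (adj? x y)) ≤⟨ *-monoʳ-≤ 3 (mantel adj? Adj-sym Adj-triangle-free) ⟩
    3 * (n * n)              ∎
    where
    open ≤-Reasoning
    Q E₁ : Fin n → Fin n → Fin n → ℕ
    E₁ x y z = 𝟙 (E? x y z)
    Q x y z = 𝟙 (selected? x y z)

    #E #Q : ℕ
    #E = ∑³ E₁
    #Q = ∑³ Q

    rearrange : ∀ q → 2 * (q + (q + q)) ≡ 3 * (2 * q)
    rearrange = solve-∀

    one-hyperedge-per-pair : #Q ≤ ∑² λ x y → 𝟙 (adj? x y)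
    one-hyperedge-per-pair = ∑²-mono-≤ λ x y →
      sum-unique≤ (selected? x y) λ _ _ → Selected-unique

    at-least-two : ∀ x y z → E₁ x y z + E₁ x y z ≤ Q x y z + (Q y z x + Q z x y)
    at-least-two x y z =
      𝟙-TwoOf (E? x y z) (selected? x y z) (selected? y z x) (selected? z x y) two-selected

    two-per-hyperedge : 2 * #E ≤ #Q + (#Q + #Q)
    two-per-hyperedge = begin
      2 * #E                                         ≡⟨ cong (#E +_) (+-identityʳ #E) ⟩
      #E + #E                                        ≡⟨ ∑³-distrib-+ E₁ E₁ ⟨
      ∑³ (λ x y z → E₁ x y z + E₁ x y z)             ≤⟨ ∑³-mono-≤ at-least-two ⟩
      ∑³ (λ x y z → Q x y z + (Q y z x + Q z x y))
        ≡⟨ ∑³-distrib-+ Q (λ x y z → Q y z x + Q z x y) ⟩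
      #Q + ∑³ (λ x y z → Q y z x + Q z x y)
        ≡⟨ cong (#Q +_) (∑³-distrib-+ (λ x y z → Q y z x) (λ x y z → Q z x y)) ⟩
      #Q + (∑³ (λ x y z → Q y z x) + ∑³ (λ x y z → Q z x y))
        ≡⟨ cong (#Q +_) (cong₂ _+_ (∑³-rotate Q) (trans (∑³-rotate (λ x y z → Q y z x)) (∑³-rotate Q))) ⟩
      #Q + (#Q + #Q)                                 ∎

-- Berge triangles among the members of a family of subsets

-- A Berge triangle without the maps `φ` and `ε`, so that it can be decided by finite search.
-- Conditions stand as soon as their variables are bound, which prunes the search early.
Triangle : Pred (Subset n) 0ℓ → Set
Triangle {n} F =
  ∃[ e ] F e × ∃[ f ] F f × e ≢ f × ∃[ g ] F g × f ≢ g × g ≢ e ×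
  ∃[ x ] (x ∈ e × x ∈ f) × ∃[ y ] (y ∈ f × y ∈ g) × x ≢ y ×
  ∃[ z ] (z ∈ g × z ∈ e) × y ≢ z × z ≢ x

infix 4 _≟ˢ_

_≟ˢ_ : (e f : Subset n) → Dec (e ≡ f)
_≟ˢ_ = Vec.≡-dec Bool._≟_

triangle? : {F : Pred (Subset n) 0ℓ} → Decidable F → Dec (Triangle F)
triangle? F? =
  anySubset? λ e → F? e ×-dec anySubset? λ f → F? f ×-dec ¬? (e ≟ˢ f) ×-dec
  anySubset? λ g → F? g ×-dec ¬? (f ≟ˢ g) ×-dec ¬? (g ≟ˢ e) ×-dec
  Fin.any? λ x → (x ∈? e ×-dec x ∈? f) ×-dec
  Fin.any? λ y → (y ∈? f ×-dec y ∈? g) ×-dec ¬? (x Fin.≟ y) ×-dec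
  Fin.any? λ z → (z ∈? g ×-dec z ∈? e) ×-dec ¬? (y Fin.≟ z) ×-dec ¬? (z Fin.≟ x)

pattern edge₀₁ = true ∷ true ∷ false ∷ []
pattern edge₁₂ = false ∷ true ∷ true ∷ []
pattern edge₀₂ = true ∷ false ∷ true ∷ []

data IsEdge : Subset 3 → Set where
  e₀₁ : IsEdge edge₀₁
  e₁₂ : IsEdge edge₁₂
  e₀₂ : IsEdge edge₀₂

isEdge : ∀ f → ∣ f ∣ ≡ 2 → IsEdge f
isEdge (true ∷ true ∷ false ∷ [])   _ = e₀₁
isEdge (false ∷ true ∷ true ∷ [])   _ = e₁₂
isEdge (true ∷ false ∷ true ∷ [])   _ = e₀₂
isEdge (true ∷ true ∷ true ∷ [])    ()
isEdge (true ∷ false ∷ false ∷ [])  ()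
isEdge (false ∷ true ∷ false ∷ [])  ()
isEdge (false ∷ false ∷ true ∷ [])  ()
isEdge (false ∷ false ∷ false ∷ []) ()

triangle⇒berge : (H : Hypergraph n) → Triangle (E H) → IsBerge (completeGraph 3) H
triangle⇒berge {n} H (e , Ee , f , Ef , e≢f , g , Eg , f≢g , g≢e ,
  x , (x∈e , x∈f) , y , (y∈f , y∈g) , x≢y , z , (z∈g , z∈e) , y≢z , z≢x) = record
  { φ          = φ
  ; φ∈V        = λ { 0F → E⊆V H e Ee x∈e ; 1F → E⊆V H f Ef y∈f ; 2F → E⊆V H g Eg z∈g }
  ; φ-inj      = φ-inj _ _
  ; ε          = ε
  ; ε∈E        = λ d p → ε∈E (isEdge d p)
  ; ε-distinct = λ d d′ p p′ → ε-distinct (isEdge d p) (isEdge d′ p′)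
  ; φ∈ε        = λ d p i → φ∈ε (isEdge d p)
  }
  where
  φ : Fin 3 → Fin n
  φ 0F = x
  φ 1F = y
  φ 2F = z

  φ-inj : ∀ i j → φ i ≡ φ j → i ≡ j
  φ-inj 0F 0F _ = refl
  φ-inj 1F 1F _ = refl
  φ-inj 2F 2F _ = refl
  φ-inj 0F 1F q = contradiction q x≢y
  φ-inj 1F 0F q = contradiction (sym q) x≢y
  φ-inj 1F 2F q = contradiction q y≢z
  φ-inj 2F 1F q = contradiction (sym q) y≢z
  φ-inj 2F 0F q = contradiction q z≢x
  φ-inj 0F 2F q = contradiction (sym q) z≢x

  ε : Subset 3 → Subset n
  ε edge₀₁ = f
  ε edge₁₂ = g
  -- Among the edges of the triangle only `edge₀₂` reaches this clause; elsewhere the value is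
  -- irrelevant.
  ε _      = e

  ε∈E : ∀ {d} → IsEdge d → E H (ε d)
  ε∈E e₀₁ = Ef
  ε∈E e₁₂ = Eg
  ε∈E e₀₂ = Ee

  ε-distinct : ∀ {d d′} → IsEdge d → IsEdge d′ → ε d ≡ ε d′ → d ≡ d′
  ε-distinct e₀₁ e₀₁ _ = refl
  ε-distinct e₁₂ e₁₂ _ = refl
  ε-distinct e₀₂ e₀₂ _ = refl
  ε-distinct e₀₁ e₁₂ q = contradiction q f≢g
  ε-distinct e₁₂ e₀₁ q = contradiction (sym q) f≢g
  ε-distinct e₁₂ e₀₂ q = contradiction q g≢e
  ε-distinct e₀₂ e₁₂ q = contradiction (sym q) g≢e
  ε-distinct e₀₂ e₀₁ q = contradiction q e≢f
  ε-distinct e₀₁ e₀₂ q = contradiction (sym q) e≢f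

  φ∈ε : ∀ {d i} → IsEdge d → i ∈ d → φ i ∈ ε d
  φ∈ε e₀₁ here                 = x∈f
  φ∈ε e₀₁ (there here)         = y∈f
  φ∈ε e₀₁ (there (there (there ())))
  φ∈ε e₁₂ (there here)         = y∈g
  φ∈ε e₁₂ (there (there here)) = z∈g
  φ∈ε e₀₂ here                 = x∈e
  φ∈ε e₀₂ (there (there here)) = z∈e

berge⇒triangle : (H : Hypergraph n) → IsBerge (completeGraph 3) H → Triangle (E H)
berge⇒triangle H B =
  ε edge₀₂ , ε∈E edge₀₂ refl ,
  ε edge₀₁ , ε∈E edge₀₁ refl , distinct refl refl (λ ()) ,
  ε edge₁₂ , ε∈E edge₁₂ refl , distinct refl refl (λ ()) , distinct refl refl (λ ()) ,
  φ 0F , (φ∈ε _ refl _ here , φ∈ε _ refl _ here) ,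
  φ 1F , (φ∈ε _ refl _ (there here) , φ∈ε _ refl _ (there here)) , φ-distinct (λ ()) ,
  φ 2F , (φ∈ε _ refl _ (there (there here)) , φ∈ε _ refl _ (there (there here))) ,
  φ-distinct (λ ()) , φ-distinct (λ ())
  where
  open IsBerge B
  distinct : ∀ {d d′} → ∣ d ∣ ≡ 2 → ∣ d′ ∣ ≡ 2 → d ≢ d′ → ε d ≢ ε d′
  distinct p p′ d≢d′ q = d≢d′ (ε-distinct _ _ p p′ q)

  φ-distinct : ∀ {i j} → i ≢ j → φ i ≢ φ j
  φ-distinct i≢j q = i≢j (φ-inj q)

Triangle-mono : {F G : Pred (Subset n) 0ℓ} → (∀ {e} → F e → G e) → Triangle F → Triangle G
Triangle-mono F⇒G (e , Fe , f , Ff , e≢f , g , Fg , rest) =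
  e , F⇒G Fe , f , F⇒G Ff , e≢f , g , F⇒G Fg , rest

-- Colour classes

ColourClass : Coloring (completeHypergraph 3 n) k → Fin k → Pred (Subset n) 0ℓ
ColourClass c i e = ∃ λ (p : ∣ e ∣ ≡ 3) → c (e , p) ≡ i

colourClass? : (c : Coloring (completeHypergraph 3 n) k) → ∀ i → Decidable (ColourClass c i)
colourClass? c i e with ∣ e ∣ ≟ 3
... | no ∣e∣≢3 = no (∣e∣≢3 ∘ proj₁)
-- Proofs of an equation in `ℕ` are unique, so the colour depends on the set alone.
... | yes p    = map′ (p ,_) (λ (q , eq) → subst (λ p → c (e , p) ≡ i) (≡-irrelevant q p) eq)
                      (c (e , p) Fin.≟ i)

monochromaticTriangle? : (c : Coloring (completeHypergraph 3 n) k) →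
                         Dec (∃[ i ] Triangle (ColourClass c i))
monochromaticTriangle? c = Fin.any? λ i → triangle? (colourClass? c i)

ramsey⇒triangle : HasRamseyProperty 3 (𝓑 (completeGraph 3)) k n →
                  (c : Coloring (completeHypergraph 3 n) k) → ∃[ i ] Triangle (ColourClass c i)
ramsey⇒triangle ramsey c with H , (_ , E⇒∣∣≡3) , (i , mono) , berge ← ramsey c =
  i , Triangle-mono (λ {e} Ee → E⇒∣∣≡3 e Ee , mono _ Ee) (berge⇒triangle H berge)

-- The whole colour class, on all vertices, serves as the monochromatic subhypergraph.
triangle⇒ramsey : ((c : Coloring (completeHypergraph 3 n) k) → ∃[ i ] Triangle (ColourClass c i)) →
                  HasRamseyProperty 3 (𝓑 (completeGraph 3)) k n
triangle⇒ramsey triangle c with i , t ← triangle c =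
  H , (⊆⊤ , λ _ → proj₁) , (i , λ e (p , eq) →
    trans (cong (λ p → c (proj₁ e , p)) (≡-irrelevant _ p)) eq) , triangle⇒berge H t
  where
  H : Hypergraph _
  H = record { V = _ ; E = ColourClass c i ; E⊆V = λ _ _ → ⊆⊤ }

-- Upper bounds

triple : Fin n → Fin n → Fin n → Subset n
triple x y z = ⁅ x ⁆ ∪ (⁅ y ⁆ ∪ ⁅ z ⁆)

triple-rotate : (x y z : Fin n) → triple x y z ≡ triple y z x
triple-rotate x y z = trans (∪-comm ⁅ x ⁆ (⁅ y ⁆ ∪ ⁅ z ⁆)) (∪-assoc ⁅ y ⁆ ⁅ z ⁆ ⁅ x ⁆)

triple-swap : (x y z : Fin n) → triple x y z ≡ triple y x z
triple-swap x y z = trans (sym (∪-assoc ⁅ x ⁆ ⁅ y ⁆ ⁅ z ⁆))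
  (trans (cong (_∪ ⁅ z ⁆) (∪-comm ⁅ x ⁆ ⁅ y ⁆)) (∪-assoc ⁅ y ⁆ ⁅ x ⁆ ⁅ z ⁆))

∈triple⁻ : {t x y z : Fin n} → t ∈ triple x y z → t ≡ x ⊎ t ≡ y ⊎ t ≡ z
∈triple⁻ {t = t} {x} {y} {z} t∈ with x∈p∪q⁻ ⁅ x ⁆ (⁅ y ⁆ ∪ ⁅ z ⁆) t∈
... | inj₁ t∈x = inj₁ (x∈⁅y⁆⇒x≡y x t∈x)
... | inj₂ t∈yz with x∈p∪q⁻ ⁅ y ⁆ ⁅ z ⁆ t∈yz
...   | inj₁ t∈y = inj₂ (inj₁ (x∈⁅y⁆⇒x≡y y t∈y))
...   | inj₂ t∈z = inj₂ (inj₂ (x∈⁅y⁆⇒x≡y z t∈z))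

first∈triple : (x y z : Fin n) → x ∈ triple x y z
first∈triple x y z = x∈p∪q⁺ (inj₁ (x∈⁅x⁆ x))

second∈triple : (x y z : Fin n) → y ∈ triple x y z
second∈triple x y z = x∈p∪q⁺ (inj₂ (x∈p∪q⁺ (inj₁ (x∈⁅x⁆ y))))

∣p∪q∣≤∣p∣+∣q∣ : (p q : Subset n) → ∣ p ∪ q ∣ ≤ ∣ p ∣ + ∣ q ∣
∣p∪q∣≤∣p∣+∣q∣ []            []            = z≤n
∣p∪q∣≤∣p∣+∣q∣ (inside ∷ p)  (inside ∷ q)  =
  s≤s (≤-trans (∣p∪q∣≤∣p∣+∣q∣ p q) (+-monoʳ-≤ ∣ p ∣ (n≤1+n ∣ q ∣)))
∣p∪q∣≤∣p∣+∣q∣ (inside ∷ p)  (outside ∷ q) = s≤s (∣p∪q∣≤∣p∣+∣q∣ p q)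
∣p∪q∣≤∣p∣+∣q∣ (outside ∷ p) (inside ∷ q)  =
  ≤-trans (s≤s (∣p∪q∣≤∣p∣+∣q∣ p q)) (≤-reflexive (sym (+-suc ∣ p ∣ ∣ q ∣)))
∣p∪q∣≤∣p∣+∣q∣ (outside ∷ p) (outside ∷ q) = ∣p∪q∣≤∣p∣+∣q∣ p q

-- A repeated vertex leaves a union of two singletons.
∣triple∣≡3⇒x≢y : {x y z : Fin n} → ∣ triple x y z ∣ ≡ 3 → x ≢ y
∣triple∣≡3⇒x≢y {x = x} {z = z} size refl = contradiction 3≤2 λ where (s≤s (s≤s ()))
  where
  open ≤-Reasoning
  3≤2 : 3 ≤ 2
  3≤2 = begin
    3                          ≡⟨ size ⟨
    ∣ triple x x z ∣           ≡⟨ cong ∣_∣ (∪-assoc ⁅ x ⁆ ⁅ x ⁆ ⁅ z ⁆) ⟨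
    ∣ (⁅ x ⁆ ∪ ⁅ x ⁆) ∪ ⁅ z ⁆ ∣ ≡⟨ cong (λ p → ∣ p ∪ ⁅ z ⁆ ∣) (∪-idem ⁅ x ⁆) ⟩
    ∣ ⁅ x ⁆ ∪ ⁅ z ⁆ ∣          ≤⟨ ∣p∪q∣≤∣p∣+∣q∣ ⁅ x ⁆ ⁅ z ⁆ ⟩
    ∣ ⁅ x ⁆ ∣ + ∣ ⁅ z ⁆ ∣      ≡⟨ cong₂ _+_ (∣⁅x⁆∣≡1 x) (∣⁅x⁆∣≡1 z) ⟩
    2                          ∎

triangle-free-bound : {F : Pred (Subset n) 0ℓ} (F? : Decidable F) →
                      (∀ {e} → F e → ∣ e ∣ ≡ 3) → ¬ Triangle F →
                      4 * ∑³ (λ x y z → 𝟙 (F? (triple x y z))) ≤ 3 * (n * n)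
triangle-free-bound {F = F} F? uniform ¬triangle =
  TripleSystem.4∑E≤3n² (λ x y z → F? (triple x y z)) swap rotate
    (∣triple∣≡3⇒x≢y ∘ uniform) berge-free
  where
  swap : ∀ {x y z} → F (triple x y z) → F (triple y x z)
  swap = subst F (triple-swap _ _ _)

  rotate : ∀ {x y z} → F (triple x y z) → F (triple y z x)
  rotate = subst F (triple-rotate _ _ _)

  distinct : ∀ {x y z} → F (triple x y z) → x ≢ y
  distinct = ∣triple∣≡3⇒x≢y ∘ uniform

  ∉triple : ∀ {t x y z : Fin _} → t ≢ x → t ≢ y → t ≢ z → t ∉ triple x y z
  ∉triple t≢x t≢y t≢z t∈ = [ t≢x , [ t≢y , t≢z ] ] (∈triple⁻ t∈)

  separate : ∀ {t} {e f : Subset _} → t ∈ e → t ∉ f → e ≢ f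
  separate t∈e t∉f refl = t∉f t∈e

  berge-free : ∀ {x y z u v w} → F (triple x y u) → F (triple y z v) → F (triple x z w) →
               u ≢ z → v ≢ x → ⊥
  -- The vertex z separates xyu from the other two hyperedges, and x separates xzw from yzv.
  berge-free {x} {y} {z} {u} {v} {w} e f g u≢z v≢x = ¬triangle
    ( triple x z w , g , triple x y u , e , separate (second∈triple x z w) z∉e
    , triple y z v , f , separate (second∈triple y z v) z∉e ∘ sym
    , separate (first∈triple x z w) x∉f ∘ sym
    , x , (first∈triple x z w , first∈triple x y u)
    , y , (second∈triple x y u , first∈triple y z v) , distinct e
    , z , (second∈triple y z v , second∈triple x z w) , distinct f , distinct g ∘ sym )
    where
    z∉e : z ∉ triple x y u
    z∉e = ∉triple (distinct g ∘ sym) (distinct f ∘ sym) (u≢z ∘ sym)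
    x∉f : x ∉ triple y z v
    x∉f = ∉triple (distinct e) (distinct g) (v≢x ∘ sym)

-- Ordered triples of distinct vertices: six times C(n,3).
#triples : ℕ → ℕ
#triples n = ∑³ {n} λ x y z → 𝟙 (∣ triple x y z ∣ ≟ 3)

-- Divided by 24, the hypothesis reads k · n²/8 < C(n,3): triangle-free classes are too small to
-- cover all triples.
ramsey-upper : 3 * (n * n) * k < 4 * #triples n →
               HasRamseyProperty 3 (𝓑 (completeGraph 3)) k n
ramsey-upper {n} {k} k*3n²<4#triples = triangle⇒ramsey λ c →
  -- Decidability of the finite search turns the refutation into an actual colour and triangle.
  decidable-stable (monochromaticTriangle? c) λ ¬mono →
    <-irrefl refl (<-≤-trans k*3n²<4#triples (count c λ i t → ¬mono (i , t)))
  where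
  open ≤-Reasoning
  count : (c : Coloring (completeHypergraph 3 n) k) → (∀ i → ¬ Triangle (ColourClass c i)) →
          4 * #triples n ≤ 3 * (n * n) * k
  count c ¬triangle = begin
    4 * #triples n
      -- Each triple of size three is counted at least in the class of its own colour.
      ≤⟨ *-monoʳ-≤ 4 (∑³-mono-≤ λ x y z → 𝟙≤ (_ ≟ 3) λ p →
           ≤-trans (𝟙-yes (colourClass? c (c (triple x y z , p)) (triple x y z)) (p , refl))
                   (term≤sum (λ i → 𝟙 (colourClass? c i (triple x y z))) (c (triple x y z , p)))) ⟩
    4 * ∑³ (λ x y z → sum λ i → 𝟙 (colourClass? c i (triple x y z)))
      ≡⟨ cong (4 *_) (∑³-∑-comm λ x y z i → 𝟙 (colourClass? c i (triple x y z))) ⟩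
    4 * sum (λ i → ∑³ λ x y z → 𝟙 (colourClass? c i (triple x y z)))
      ≡⟨ *-distribˡ-sum 4 (λ i → ∑³ λ x y z → 𝟙 (colourClass? c i (triple x y z))) ⟩
    sum (λ i → 4 * ∑³ λ x y z → 𝟙 (colourClass? c i (triple x y z)))
      ≤⟨ sum-mono-≤ (λ i → triangle-free-bound (colourClass? c i) proj₁ (¬triangle i)) ⟩
    sum {k} (λ _ → 3 * (n * n))
      ≡⟨ trans (sum-const k (3 * (n * n))) (*-comm k (3 * (n * n))) ⟩
    3 * (n * n) * k ∎

-- Lower bounds

-- Vertices are numbered from 1; a triple of vertices is written as the
-- decimal numeral of its members in increasing order.
numeral : Subset m → ℕ
numeral = go 1 0
  where
  go : ℕ → ℕ → Subset m → ℕ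
  go v acc []            = acc
  go v acc (inside  ∷ e) = go (suc v) (acc * 10 + v) e
  go v acc (outside ∷ e) = go (suc v) acc e

-- Every triple outside the listed classes receives the last colour.
colour : Vec (List ℕ) k → ℕ → Fin (suc k)
colour []             t = zero
colour (class ∷ rest) t = if any (t ≡ᵇ_) class then zero else suc (colour rest t)

tableColoring : Vec (List ℕ) k → ∀ m → Coloring (completeHypergraph 3 m) (suc k)
tableColoring table m (e , _) = colour table (numeral e)

-- Leastness concerns every `m < n`; a single table serves them all, read on the first `m` vertices.
lower? : (table : Vec (List ℕ) k) → ∀ n →
         Dec (∀ {m} → m < n → ¬ (∃[ i ] Triangle (ColourClass (tableColoring table m) i)))
lower? table = allUpTo? λ m → ¬? (monochromaticTriangle? (tableColoring table m))

-- Both bounds are closed decidable statements; evaluation solves the implicit `True` arguments.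
ramseyNumber : (table : Vec (List ℕ) k) →
               {True (lower? table n)} → {True (3 * (n * n) * suc k <? 4 * #triples n)} →
               RamseyNumber 3 (𝓑 (completeGraph 3)) (suc k) n
ramseyNumber {k} {n} table {lower} {upper} = ramsey-upper (toWitness upper) , λ m ramsey →
  ≮⇒≥ λ m<n → toWitness lower m<n (ramsey⇒triangle ramsey (tableColoring table m))

theorem1 : let 𝓕 = 𝓑 (completeGraph 3) in
    RamseyNumber 3 𝓕 2 5 ×
    RamseyNumber 3 𝓕 3 5 ×
    RamseyNumber 3 𝓕 4 6 ×
    RamseyNumber 3 𝓕 5 7 ×
    RamseyNumber 3 𝓕 6 8 ×
    RamseyNumber 3 𝓕 8 9
theorem1 =
  -- Four vertices carry four triples, and a class of two has too few hyperedges for a triangle.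
  ramseyNumber ((123 ∷ 134 ∷ []) ∷ []) ,
  ramseyNumber ((123 ∷ 134 ∷ []) ∷ (124 ∷ 234 ∷ []) ∷ []) ,
  -- Classes of two triples, or of three through a common pair (35, and 12 for the last colour); in
  -- the latter all pairwise intersections lie in that pair, leaving no third vertex.
  ramseyNumber
    ( (145 ∷ 234 ∷ []) ∷ (135 ∷ 235 ∷ 345 ∷ []) ∷ (134 ∷ 245 ∷ []) ∷ [] ) ,
  -- From a decomposition of the edges of K₆ into five perfect matchings: the matching a6, p, q
  -- gives the class in which the pairs p and q are each joined to a and to 6.
  ramseyNumber
    ( (125 ∷ 126 ∷ 345 ∷ 346 ∷ [])
    ∷ (134 ∷ 136 ∷ 245 ∷ 256 ∷ [])
    ∷ (135 ∷ 156 ∷ 234 ∷ 246 ∷ [])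
    ∷ (124 ∷ 146 ∷ 235 ∷ 356 ∷ [])
    ∷ [] ) ,
  -- The bound 49/8 allows six triples per class, so the 35 triples force class sizes 6, 6, 6, 6, 6,
  -- 5. The class of five consists of the triples through 36; each other class joins two disjoint
  -- pairs to the remaining three vertices.
  ramseyNumber
    ( (135 ∷ 156 ∷ 157 ∷ 234 ∷ 246 ∷ 247 ∷ [])
    ∷ (123 ∷ 124 ∷ 126 ∷ 357 ∷ 457 ∷ 567 ∷ [])
    ∷ (136 ∷ 236 ∷ 346 ∷ 356 ∷ 367 ∷ [])
    ∷ (134 ∷ 145 ∷ 146 ∷ 237 ∷ 257 ∷ 267 ∷ [])
    ∷ (125 ∷ 147 ∷ 235 ∷ 256 ∷ 347 ∷ 467 ∷ [])
    ∷ [] ) ,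
  -- Classes have at most 64/8 = 8 triples, so eight colours leave some slack over the 56 triples.
  -- The four classes of size eight, the last colour among them, join two disjoint pairs to the
  -- remaining four vertices.
  ramseyNumber
    ( (138 ∷ 238 ∷ 456 ∷ 567 ∷ [])
    ∷ (147 ∷ 158 ∷ 247 ∷ 258 ∷ 347 ∷ 358 ∷ 467 ∷ 568 ∷ [])
    ∷ (135 ∷ 145 ∷ 156 ∷ 278 ∷ 378 ∷ 478 ∷ 678 ∷ [])
    ∷ (123 ∷ 148 ∷ 235 ∷ 236 ∷ 237 ∷ 458 ∷ 468 ∷ [])
    ∷ (134 ∷ 256 ∷ 267 ∷ 268 ∷ 345 ∷ 348 ∷ [])
    ∷ (126 ∷ 136 ∷ 146 ∷ 168 ∷ 257 ∷ 357 ∷ 457 ∷ 578 ∷ [])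
    ∷ (124 ∷ 125 ∷ 127 ∷ 128 ∷ 346 ∷ 356 ∷ 367 ∷ 368 ∷ [])
    ∷ [] )
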